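{- Let $G=(V,E)$ be a finite simple graph with $V\neq\emptyset$ and $E\neq\emptyset$, and fix $e\in E$. For $i\geq 1$ let $$a_i(G)=\sum_{\substack{F\subseteq E\\ k(F)=i}}(-1)^{|F|}.$$ Let $b_e^0(G)=0$ and, for $i\geq 1$, $$b_e^i(G)=\sum_{F\in\mathcal{B}_e^i}(-1)^{|F|},$$ where $\mathcal{B}_e^i$ is the collection of all $F\subseteq E$ such that $e$ is a bridge in $F$ and $k(F)=i$. Then for all $i\geq 1$, $$a_i(G)=b_e^i(G)-b_e^{i-1}(G).$$
   Context: For $F\subseteq E$, $k(F)$ denotes the number of connected components of the spanning subgraph $(V,F)$ (isolated vertices count as components). An edge $e$ is a bridge in $F$ if $e\in F$ and $k(F\setminus\{e\})=k(F)+1$. The numbers $a_i(G)$, $1\leq i\leq |V|$, are the coefficients of the chromatic polynomial of $G$, $\chi_G(\lambda)=\sum_{i=1}^{|V|}a_i(G)\lambda^i$. -}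

module Defs where

open import Data.Fin.Base using (Fin)
open import Data.Fin.Properties using (_≟_; any?)
open import Data.Fin.Subset using (Subset; inside; outside; _∈_; ∣_∣; _-_)
open import Data.Fin.Subset.Properties using (_∈?_)
open import Data.Integer.Base as ℤ using (ℤ; 0ℤ; -1ℤ)
open import Data.List.Base
  using (List; []; _∷_; [_]; _++_; map; filter; foldr; length; deduplicate; allFin)
import Data.List.Membership.Propositional as List
open import Data.List.Membership.Propositional.Properties using (∈-allFin)
open import Data.List.Relation.Unary.Any using (here; there)
open import Data.Nat.Base using (ℕ; zero; suc; _+_)
import Data.Nat.Properties as ℕ
open import Data.Product.Base using (_×_; _,_; ∃-syntax)
open import Data.Sum.Base using (_⊎_; inj₁; inj₂)
import Data.Vec.Base as Vec
open import Level using (0ℓ)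
open import Relation.Binary.Construct.Closure.ReflexiveTransitive
  using (Star; ε; _◅_; _◅◅_)
open import Relation.Binary.Core using (Rel)
open import Relation.Binary.Definitions using (Decidable)
open import Relation.Binary.PropositionalEquality using (_≡_; refl)
open import Relation.Nullary using (¬_)
open import Relation.Nullary.Decidable using (map′; _×-dec_; _⊎-dec_)
import Relation.Unary as Unary

-- The vertices are Fin order and the edges are Fin size.  Each edge is stored
-- with an arbitrary orientation, but only its unordered pair of ends, as
-- expressed by Joins, is ever used.
record SimpleGraph : Set where
  field
    order : ℕ
    size  : ℕ

  V : Set
  V = Fin order

  E : Set
  E = Fin size

  field
    source target : E → V

  Joins : E → V → V → Set
  Joins e u v = (source e ≡ u × target e ≡ v) ⊎ (source e ≡ v × target e ≡ u)

  field
    loopless   : ∀ e v → ¬ Joins e v v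
    noParallel : ∀ e f u v → Joins e u v → Joins f u v → e ≡ f

  joins? : ∀ e → Decidable (Joins e)
  joins? e u v = (source e ≟ u ×-dec target e ≟ v)
           ⊎-dec (source e ≟ v ×-dec target e ≟ u)

-- Star R is decidable for decidable R on Fin n.  Via R xs u v holds when v
-- can be reached from u through intermediate points taken from xs.
module _ {n : ℕ} {R : Rel (Fin n) 0ℓ} where

  Via : List (Fin n) → Rel (Fin n) 0ℓ
  Via []       u v = u ≡ v ⊎ R u v
  Via (x ∷ xs) u v = Via xs u v ⊎ (Via xs u x × Via xs x v)

  via? : Decidable R → ∀ xs → Decidable (Via xs)
  via? R? []       u v = u ≟ v ⊎-dec R? u v
  via? R? (x ∷ xs) u v =
    via? R? xs u v ⊎-dec (via? R? xs u x ×-dec via? R? xs x v)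

  via⇒star : ∀ xs {u v} → Via xs u v → Star R u v
  via⇒star []       (inj₁ refl)    = ε
  via⇒star []       (inj₂ r)       = r ◅ ε
  via⇒star (x ∷ xs) (inj₁ p)       = via⇒star xs p
  via⇒star (x ∷ xs) (inj₂ (p , q)) = via⇒star xs p ◅◅ via⇒star xs q

  via-refl : ∀ xs {u} → Via xs u u
  via-refl []       = inj₁ refl
  via-refl (x ∷ xs) = inj₁ (via-refl xs)

  via-step : ∀ xs {u v} → R u v → Via xs u v
  via-step []       r = inj₂ r
  via-step (x ∷ xs) r = inj₁ (via-step xs r)

  via-to-head : ∀ x xs {u} → Via (x ∷ xs) u x → Via xs u x
  via-to-head x xs (inj₁ p)       = p
  via-to-head x xs (inj₂ (p , _)) = p

  via-from-head : ∀ x xs {v} → Via (x ∷ xs) x v → Via xs x v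
  via-from-head x xs (inj₁ p)       = p
  via-from-head x xs (inj₂ (_ , p)) = p

  via-trans : ∀ xs {u w v} → w List.∈ xs → Via xs u w → Via xs w v → Via xs u v
  via-trans (x ∷ xs) (here refl) p q =
    inj₂ (via-to-head x xs p , via-from-head x xs q)
  via-trans (x ∷ xs) (there m) (inj₁ p) (inj₁ q) = inj₁ (via-trans xs m p q)
  via-trans (x ∷ xs) (there m) (inj₁ p) (inj₂ (q , q′)) =
    inj₂ (via-trans xs m p q , q′)
  via-trans (x ∷ xs) (there m) (inj₂ (p , p′)) (inj₁ q) =
    inj₂ (p , via-trans xs m p′ q)
  via-trans (x ∷ xs) (there m) (inj₂ (p , _)) (inj₂ (_ , q)) = inj₂ (p , q)

  star⇒via : ∀ {u v} → Star R u v → Via (allFin n) u v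
  star⇒via ε        = via-refl (allFin n)
  star⇒via (r ◅ rs) =
    via-trans (allFin n) (∈-allFin _) (via-step (allFin n) r) (star⇒via rs)

  star? : Decidable R → Decidable (Star R)
  star? R? u v =
    map′ (via⇒star (allFin n)) star⇒via (via? R? (allFin n) u v)

module _ (G : SimpleGraph) where
  open SimpleGraph G

  Adjacent : Subset size → Rel V 0ℓ
  Adjacent F u v = ∃[ e ] (e ∈ F × Joins e u v)

  adjacent? : ∀ F → Decidable (Adjacent F)
  adjacent? F u v = any? λ e → e ∈? F ×-dec joins? e u v

  Connected : Subset size → Rel V 0ℓ
  Connected F = Star (Adjacent F)

  connected? : ∀ F → Decidable (Connected F)
  connected? F = star? (adjacent? F)

  -- deduplicate keeps exactly one vertex of each connected component of (V , F).
  k : Subset size → ℕ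
  k F = length (deduplicate (connected? F) (allFin order))

  IsBridge : E → Subset size → Set
  IsBridge e F = e ∈ F × k (F - e) ≡ k F + 1

  isBridge? : ∀ e → Unary.Decidable (IsBridge e)
  isBridge? e F = e ∈? F ×-dec k (F - e) ℕ.≟ k F + 1

-- Every subset of Fin n is listed exactly once.
subsets : ∀ n → List (Subset n)
subsets zero    = [ Vec.[] ]
subsets (suc n) = map (outside Vec.∷_) (subsets n) ++ map (inside Vec.∷_) (subsets n)

-- The sum of (-1)^|F| over the subsets F of Fin n that satisfy P.
signedSum : ∀ {n} {P : Subset n → Set} → Unary.Decidable P → ℤ
signedSum {n} P? =
  foldr ℤ._+_ 0ℤ (map (λ F → -1ℤ ℤ.^ ∣ F ∣) (filter P? (subsets n)))

module _ (G : SimpleGraph) where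
  open SimpleGraph G

  a : ℕ → ℤ
  a i = signedSum λ F → k G F ℕ.≟ i

  b : E → ℕ → ℤ
  b e zero      = 0ℤ
  b e i@(suc _) = signedSum λ F → isBridge? G e F ×-dec k G F ℕ.≟ i

{-# OPTIONS --safe #-}
module Submission where

-- Pair every F containing e with F - e: the two signs are opposite.  Deleting e
-- either keeps the number of components, and then the pair contributes 0 to
-- both sides, or raises it by one, and then e is a bridge in F, F contributes
-- to a i what it contributes to b e i, and F - e contributes to a i what F
-- contributes to - b e (i - 1).

open import Defs
open import Data.Nat.Base using (ℕ; _<_; _≤_; _∸_)
open import Data.Integer.Base using (_-_)
open import Relation.Binary.PropositionalEquality using (_≡_)
open SimpleGraph using (order; size; E)

import Data.Integer.Properties as ℤ
open import Algebra.Properties.AbelianGroup ℤ.+-0-abelianGroup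
  using (//-rightDividesʳ; xyx⁻¹≈y)
open import Algebra.Properties.CommutativeSemigroup using (interchange)
open import Data.Bool.Base using (true; false; if_then_else_; _∧_)
open import Data.Fin.Base using (Fin; zero; suc)
import Data.Fin.Properties as Fin
open import Data.Fin.Subset as Subset using (Subset; inside; outside; _∈_; _∉_; ∣_∣; ⁅_⁆)
open import Data.Fin.Subset.Properties
  using (_∈?_; p─⊥≡p; drop-there; x∈p∧x≢y⇒x∈p-y; p─q⊆p)
open import Data.Integer.Base as ℤ using (ℤ; 0ℤ; -1ℤ; _+_; -_)
open import Data.List.Base
  using (List; []; _∷_; _++_; map; filter; foldr; length; deduplicate; allFin)
open import Data.List.Membership.Propositional using (find; lose)
open import Data.List.Properties using (map-∘; filter-all; filter-none)
import Data.List.Relation.Unary.All as All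
import Data.List.Relation.Unary.All.Properties as All
open import Data.List.Relation.Unary.AllPairs using (AllPairs; _∷_)
open import Data.List.Relation.Unary.Any as Any using (Any; here; there)
import Data.List.Relation.Unary.Any.Properties as Any
open import Data.List.Relation.Unary.Unique.DecSetoid.Properties using (deduplicate-!)
import Data.Nat.Base as ℕ
import Data.Nat.Properties as ℕ
open import Data.Product.Base using (_×_; _,_)
open import Data.Sum.Base using (_⊎_; inj₁; inj₂; swap)
open import Data.Vec.Base as Vec using ([]; _∷_)
open import Function.Base using (_∘_)
open import Level using (Level)
open import Relation.Binary.Construct.Closure.ReflexiveTransitive
  as Star using (ε; _◅_; _◅◅_; reverse)
open import Relation.Binary.Core using (Rel; _⇒_)
open import Relation.Binary.Definitions using (Decidable)
open import Relation.Binary.PropositionalEquality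
  using (_≢_; refl; sym; trans; cong; cong₂; subst; module ≡-Reasoning)
open import Relation.Binary.Structures using (IsDecEquivalence)
open import Relation.Nullary using (¬_; yes; no; does; ¬?; contradiction)
open import Relation.Nullary.Decidable using (_×-dec_; dec-true; dec-false)
import Relation.Unary as Unary

private
  variable
    α ℓ₁ ℓ₂ : Level
    A : Set α
    n : ℕ

-- Counting the equivalence classes met by a list.

module Classes {R : Rel A ℓ₁} (isDecEquivalence : IsDecEquivalence R) where
  open IsDecEquivalence isDecEquivalence
    using (_≟_) renaming (refl to R-refl; sym to R-sym; trans to R-trans)

  classes : List A → ℕ
  classes xs = length (deduplicate _≟_ xs)

  -- Two entries related to `x` would be related to each other, so the filter drops exactly one
  -- entry.
  length-remove : ∀ {x ys} → Any (R x) ys → AllPairs (λ y z → ¬ R y z) ys →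
    ℕ.suc (length (filter (¬? ∘ (x ≟_)) ys)) ≡ length ys
  length-remove {x} {y ∷ ys} p (y# ∷ u) with x ≟ y
  ... | yes xRy = cong (ℕ.suc ∘ length)
    (filter-all (¬? ∘ (x ≟_)) (All.map (λ ¬yRz xRz → ¬yRz (R-trans (R-sym xRy) xRz)) y#))
  length-remove (here xRy) _       | no ¬xRy = contradiction xRy ¬xRy
  length-remove (there p)  (_ ∷ u) | no _    = cong ℕ.suc (length-remove p u)

  -- `deduplicate` keeps `x` and discards the representative its class already had in the tail, so
  -- the length does not change.
  classes-seen : ∀ {x xs} → Any (R x) xs → classes (x ∷ xs) ≡ classes xs
  classes-seen {xs = xs} p = length-remove
    (Any.deduplicate⁺ _≟_ (λ yRz xRz → R-trans xRz (R-sym yRz)) p)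
    (deduplicate-! (record { isDecEquivalence = isDecEquivalence }) xs)

  classes-new : ∀ {x xs} → ¬ Any (R x) xs → classes (x ∷ xs) ≡ ℕ.suc (classes xs)
  classes-new {x} ¬p = cong (ℕ.suc ∘ length)
    (filter-all (¬? ∘ (x ≟_)) (All.deduplicate⁺ _≟_ (All.¬Any⇒All¬ _ ¬p)))

open Classes using (classes; classes-seen; classes-new)

-- For an equivalence relation `R`, this is `R` with the classes of `s` and `t` fused. Three
-- explicit cases replace a transitive closure, because identifying `s` with `t` more than once
-- gains nothing.
Merge : Rel A ℓ₁ → A → A → Rel A ℓ₁
Merge R s t u v = R u v ⊎ (R u s × R t v) ⊎ (R u t × R s v)

module _ {R : Rel A ℓ₁} {R′ : Rel A ℓ₂}
         (isR : IsDecEquivalence R) (isR′ : IsDecEquivalence R′)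
         (R⇒R′ : R ⇒ R′) {s t : A} (R′⇒Merge : R′ ⇒ Merge R s t) where
  private
    module R  = IsDecEquivalence isR
    module R′ = IsDecEquivalence isR′

  -- In the second case xs meets the classes of both s and t; carrying this
  -- along is what excludes a second drop.
  classes-merge′ : ∀ xs →
    classes isR xs ≡ classes isR′ xs ⊎
    (classes isR xs ≡ ℕ.suc (classes isR′ xs) × Any (R s) xs × Any (R t) xs)
  classes-merge′ [] = inj₁ refl
  classes-merge′ (x ∷ xs) with Any.any? (x R.≟_) xs | Any.any? (x R′.≟_) xs
  ... | yes p | no ¬q = contradiction (Any.map R⇒R′ p) ¬q
  ... | yes p | yes q
    rewrite classes-seen isR p | classes-seen isR′ q with classes-merge′ xs
  ...   | inj₁ eq            = inj₁ eq
  ...   | inj₂ (eq , sᵣ , tᵣ) = inj₂ (eq , there sᵣ , there tᵣ)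
  classes-merge′ (x ∷ xs) | no ¬p | no ¬q
    rewrite classes-new isR ¬p | classes-new isR′ ¬q with classes-merge′ xs
  ...   | inj₁ eq            = inj₁ (cong ℕ.suc eq)
  ...   | inj₂ (eq , sᵣ , tᵣ) = inj₂ (cong ℕ.suc eq , there sᵣ , there tᵣ)
  classes-merge′ (x ∷ xs) | no ¬p | yes q
    rewrite classes-new isR ¬p | classes-seen isR′ q
    with find q
  ...   | y , y∈xs , xR′y with R′⇒Merge xR′y | classes-merge′ xs
  ...   | inj₁ xRy | _ = contradiction (lose y∈xs xRy) ¬p
  ...   | inj₂ (inj₁ (xRs , tRy)) | inj₁ eq =
    inj₂ (cong ℕ.suc eq , here (R.sym xRs) , there (lose y∈xs tRy))
  ...   | inj₂ (inj₂ (xRt , sRy)) | inj₁ eq =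
    inj₂ (cong ℕ.suc eq , there (lose y∈xs sRy) , here (R.sym xRt))
  ...   | inj₂ (inj₁ (xRs , _)) | inj₂ (_ , sᵣ , _) =
    contradiction (Any.map (R.trans xRs) sᵣ) ¬p
  ...   | inj₂ (inj₂ (xRt , _)) | inj₂ (_ , _ , tᵣ) =
    contradiction (Any.map (R.trans xRt) tᵣ) ¬p

  classes-merge : ∀ xs →
    classes isR xs ≡ classes isR′ xs ⊎ classes isR xs ≡ ℕ.suc (classes isR′ xs)
  classes-merge xs with classes-merge′ xs
  ... | inj₁ eq       = inj₁ eq
  ... | inj₂ (eq , _) = inj₂ eq

length-deduplicate≢0 : {R : Rel (Fin n) ℓ₁} (R? : Decidable R) → 0 < n →
  length (deduplicate R? (allFin n)) ≢ 0
length-deduplicate≢0 R? (ℕ.s≤s _) ()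

-- Deleting an element from a finite subset.

x∉p-x : ∀ (x : Fin n) p → x ∉ p Subset.- x
x∉p-x zero    (_ ∷ _) ()
x∉p-x (suc x) (_ ∷ p) x∈ = x∉p-x x p (drop-there x∈)

∣p∣≡1+∣p-x∣ : ∀ {x : Fin n} {p} → x ∈ p → ∣ p ∣ ≡ ℕ.suc ∣ p Subset.- x ∣
∣p∣≡1+∣p-x∣ {p = inside ∷ p} Vec.here =
  cong (ℕ.suc ∘ ∣_∣) (sym (p─⊥≡p p))
∣p∣≡1+∣p-x∣ {p = inside  ∷ _} (Vec.there x∈p) = cong ℕ.suc (∣p∣≡1+∣p-x∣ x∈p)
∣p∣≡1+∣p-x∣ {p = outside ∷ _} (Vec.there x∈p) = ∣p∣≡1+∣p-x∣ x∈p

-- Effect of deleting an edge on connectivity.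

module _ (G : SimpleGraph) where
  private
    open module G = SimpleGraph G using (source; target)

  connected-isDecEquivalence : ∀ F → IsDecEquivalence (Connected G F)
  connected-isDecEquivalence F = record
    { isEquivalence = record
      { refl  = ε
      ; sym   = reverse λ (e , e∈F , e-joins) → e , e∈F , swap e-joins
      ; trans = _◅◅_
      }
    ; _≟_ = connected? G F
    }

  module _ (e : E G) (F : Subset G.size) where

    connected-delete⇒connected : Connected G (F Subset.- e) ⇒ Connected G F
    connected-delete⇒connected =
      Star.map λ (f , f∈F-e , f-joins) → f , p─q⊆p F ⁅ e ⁆ f∈F-e , f-joins

    -- Induction on the walk. When it starts by crossing `e`, whatever the remainder does before its
    -- own crossing of `e` can be discarded, so at most one crossing survives.
    connected⇒merge :
      Connected G F ⇒ Merge (Connected G (F Subset.- e)) (source e) (target e)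
    connected⇒merge ε = inj₁ ε
    connected⇒merge ((f , f∈F , f-joins) ◅ ws)
      with f Fin.≟ e | f-joins | connected⇒merge ws
    ... | yes refl | inj₁ (refl , refl) | inj₁ p              = inj₂ (inj₁ (ε , p))
    ... | yes refl | inj₁ (refl , refl) | inj₂ (inj₁ (_ , q)) = inj₂ (inj₁ (ε , q))
    -- The remainder crosses `e` back to the starting vertex, so both crossings cancel and only the
    -- last stretch `q` is kept.
    ... | yes refl | inj₁ (refl , refl) | inj₂ (inj₂ (_ , q)) = inj₁ q
    ... | yes refl | inj₂ (refl , refl) | inj₁ p              = inj₂ (inj₂ (ε , p))
    ... | yes refl | inj₂ (refl , refl) | inj₂ (inj₁ (_ , q)) = inj₁ q
    ... | yes refl | inj₂ (refl , refl) | inj₂ (inj₂ (_ , q)) = inj₂ (inj₂ (ε , q))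
    ... | no f≢e | _ | w with f , x∈p∧x≢y⇒x∈p-y f∈F f≢e , f-joins
    ...   | r with w
    ...     | inj₁ p              = inj₁ (r ◅ p)
    ...     | inj₂ (inj₁ (p , q)) = inj₂ (inj₁ (r ◅ p , q))
    ...     | inj₂ (inj₂ (p , q)) = inj₂ (inj₂ (r ◅ p , q))

    -- Putting `e` back can only fuse the components of its two ends.
    k-delete : k G (F Subset.- e) ≡ k G F ⊎ k G (F Subset.- e) ≡ ℕ.suc (k G F)
    k-delete = classes-merge
      (connected-isDecEquivalence (F Subset.- e)) (connected-isDecEquivalence F)
      connected-delete⇒connected connected⇒merge (allFin G.order)

-- Integer sums over all subsets.

∑ : (A → ℤ) → List A → ℤ
∑ g xs = foldr _+_ 0ℤ (map g xs)

∑-++ : ∀ (g : A → ℤ) xs ys → ∑ g (xs ++ ys) ≡ ∑ g xs + ∑ g ys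
∑-++ g []       ys = sym (ℤ.+-identityˡ _)
∑-++ g (x ∷ xs) ys =
  trans (cong (g x +_) (∑-++ g xs ys)) (sym (ℤ.+-assoc (g x) (∑ g xs) (∑ g ys)))

∑-+ : ∀ (g h : A → ℤ) xs → ∑ (λ x → g x + h x) xs ≡ ∑ g xs + ∑ h xs
∑-+ g h []       = refl
∑-+ g h (x ∷ xs) = trans (cong (g x + h x +_) (∑-+ g h xs))
  (interchange ℤ.+-commutativeSemigroup (g x) (h x) (∑ g xs) (∑ h xs))

∑-cong : ∀ {g h : A → ℤ} → (∀ x → g x ≡ h x) → ∀ xs → ∑ g xs ≡ ∑ h xs
∑-cong g≗h []       = refl
∑-cong g≗h (x ∷ xs) = cong₂ _+_ (g≗h x) (∑-cong g≗h xs)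

-- Turning the filter into a zero weight gives every sum the same index list, so that sums with
-- different conditions can be added and compared termwise.
∑-filter : ∀ {P : A → Set ℓ₁} (P? : Unary.Decidable P) (g : A → ℤ) xs →
  ∑ g (filter P? xs) ≡ ∑ (λ x → if does (P? x) then g x else 0ℤ) xs
∑-filter P? g [] = refl
∑-filter P? g (x ∷ xs) with does (P? x)
... | true  = cong (g x +_) (∑-filter P? g xs)
... | false = trans (∑-filter P? g xs) (sym (ℤ.+-identityˡ _))

∑-subsets-suc : ∀ (g : Subset (ℕ.suc n) → ℤ) →
  ∑ g (subsets (ℕ.suc n)) ≡
  ∑ (g ∘ (outside ∷_)) (subsets n) + ∑ (g ∘ (inside ∷_)) (subsets n)
∑-subsets-suc {n} g = trans
  (∑-++ g (map (outside ∷_) (subsets n)) (map (inside ∷_) (subsets n)))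
  (sym (cong₂ _+_ (cong (foldr _+_ 0ℤ) (map-∘ (subsets n)))
                  (cong (foldr _+_ 0ℤ) (map-∘ (subsets n)))))

-- The subsets split into pairs formed by some `F` containing `e` and its deletion `F - e`, so
-- comparing pair sums suffices. The induction descends to the coordinate `e`, where the two halves
-- of the list are matched.
∑-subsets-pair : ∀ (e : Fin n) {g h : Subset n → ℤ} →
  (∀ F → e ∈ F → g (F Subset.- e) + g F ≡ h (F Subset.- e) + h F) →
  ∑ g (subsets n) ≡ ∑ h (subsets n)
∑-subsets-pair {ℕ.suc n} zero {g} {h} pair = begin
  ∑ g (subsets (ℕ.suc n))
    ≡⟨ split g ⟩
  ∑ (λ F → g (outside ∷ F) + g (inside ∷ F)) (subsets n)
    ≡⟨ ∑-cong pair′ (subsets n) ⟩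
  ∑ (λ F → h (outside ∷ F) + h (inside ∷ F)) (subsets n)
    ≡⟨ split h ⟨
  ∑ h (subsets (ℕ.suc n))  ∎
  where
  open ≡-Reasoning
  split : ∀ f → ∑ f (subsets (ℕ.suc n)) ≡
    ∑ (λ F → f (outside ∷ F) + f (inside ∷ F)) (subsets n)
  split f = trans (∑-subsets-suc f)
    (sym (∑-+ (f ∘ (outside ∷_)) (f ∘ (inside ∷_)) (subsets n)))
  pair′ : ∀ F → g (outside ∷ F) + g (inside ∷ F) ≡ h (outside ∷ F) + h (inside ∷ F)
  -- Deleting `zero` from `inside ∷ F` computes to `outside ∷ (F ─ ⊥)`, hence the transport along
  -- `p─⊥≡p`.
  pair′ F = subst
    (λ F′ → g (outside ∷ F′) + g (inside ∷ F) ≡ h (outside ∷ F′) + h (inside ∷ F))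
    (p─⊥≡p F) (pair (inside ∷ F) Vec.here)
∑-subsets-pair {ℕ.suc n} (suc e) {g} {h} pair = begin
  ∑ g (subsets (ℕ.suc n))  ≡⟨ ∑-subsets-suc g ⟩
  ∑ (g ∘ (outside ∷_)) (subsets n) + ∑ (g ∘ (inside ∷_)) (subsets n)
    ≡⟨ cong₂ _+_ (∑-subsets-pair e λ F e∈F → pair (outside ∷ F) (Vec.there e∈F))
                 (∑-subsets-pair e λ F e∈F → pair (inside ∷ F) (Vec.there e∈F)) ⟩
  ∑ (h ∘ (outside ∷_)) (subsets n) + ∑ (h ∘ (inside ∷_)) (subsets n)
    ≡⟨ ∑-subsets-suc h ⟨
  ∑ h (subsets (ℕ.suc n))  ∎
  where open ≡-Reasoning

-- Signs and the contribution of one pair.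

sign : Subset n → ℤ
sign F = -1ℤ ℤ.^ ∣ F ∣

sign-delete : ∀ {e : Fin n} {F} → e ∈ F → sign F ≡ - sign (F Subset.- e)
sign-delete {e = e} {F} e∈F = trans (cong (-1ℤ ℤ.^_) (∣p∣≡1+∣p-x∣ e∈F))
  (ℤ.-1*i≡-i (sign (F Subset.- e)))

-- m and m′ are the component counts of F and F - e, and s is the sign of F - e.
pair-balance : ∀ m m′ j s → m′ ≡ m ⊎ m′ ≡ ℕ.suc m →
  (if does (m′ ℕ.≟ ℕ.suc j) then s else 0ℤ) +
  ((if does (m ℕ.≟ ℕ.suc j) then - s else 0ℤ) +
   (if does (m′ ℕ.≟ m ℕ.+ 1) ∧ does (m ℕ.≟ j) then - s else 0ℤ))
  ≡ (if does (m′ ℕ.≟ m ℕ.+ 1) ∧ does (m ℕ.≟ ℕ.suc j) then - s else 0ℤ)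
pair-balance m _ j s (inj₁ refl)
  rewrite dec-false (m ℕ.≟ m ℕ.+ 1) (ℕ.m+1+n≢m m ∘ sym)
  with does (m ℕ.≟ ℕ.suc j)
... | true  = trans (cong (s +_) (ℤ.+-identityʳ (- s))) (ℤ.+-inverseʳ s)
... | false = refl
pair-balance m _ j s (inj₂ refl)
  rewrite dec-true (ℕ.suc m ℕ.≟ m ℕ.+ 1) (ℕ.+-comm 1 m)
  -- Since `suc m ≟ suc j` and `m ≟ j` have the same truth value, this one split decides both the
  -- first and the last summand on the left; they are both 0 or they cancel.
  with does (m ℕ.≟ j)
... | false = trans (ℤ.+-identityˡ _) (ℤ.+-identityʳ _)
... | true  = trans (sym (ℤ.+-assoc s x (- s))) (xyx⁻¹≈y s x)
  where x = if does (m ℕ.≟ ℕ.suc j) then - s else 0ℤ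

-- The recurrence for the coefficients.

module _ (G : SimpleGraph) (e : E G) where

  isBridge×k? : ∀ i → Unary.Decidable (λ F → IsBridge G e F × k G F ≡ i)
  isBridge×k? i F = isBridge? G e F ×-dec k G F ℕ.≟ i

  aTerm : ℕ → Subset (size G) → ℤ
  aTerm i F = if does (k G F ℕ.≟ i) then sign F else 0ℤ

  bTerm : ℕ → Subset (size G) → ℤ
  bTerm i F = if does (isBridge×k? i F) then sign F else 0ℤ

  a≡∑aTerm : ∀ i → a G i ≡ ∑ (aTerm i) (subsets (size G))
  a≡∑aTerm i = ∑-filter (λ F → k G F ℕ.≟ i) sign (subsets (size G))

  -- The conventional value 0 at index 0 agrees with the sum there: a graph with a vertex has a
  -- component, so that sum is empty. Index 0 then needs no separate treatment.
  b≡signedSum : 0 < order G → ∀ i → b G e i ≡ signedSum (isBridge×k? i)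
  b≡signedSum _   (ℕ.suc _) = refl
  b≡signedSum 0<V ℕ.zero    = cong (∑ sign) (sym (filter-none (isBridge×k? 0)
    (All.universal (λ F (_ , k≡0) → length-deduplicate≢0 (connected? G F) 0<V k≡0)
      (subsets (size G)))))

  b≡∑bTerm : 0 < order G → ∀ i → b G e i ≡ ∑ (bTerm i) (subsets (size G))
  b≡∑bTerm 0<V i =
    trans (b≡signedSum 0<V i) (∑-filter (isBridge×k? i) sign (subsets (size G)))

  bTerm-delete : ∀ i F → bTerm i (F Subset.- e) ≡ 0ℤ
  bTerm-delete i F
    rewrite dec-false (e ∈? (F Subset.- e)) (x∉p-x e F) = refl

  bTerm-∈ : ∀ i {F} → e ∈ F → bTerm i F ≡
    (if does (k G (F Subset.- e) ℕ.≟ k G F ℕ.+ 1) ∧ does (k G F ℕ.≟ i)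
     then - sign (F Subset.- e) else 0ℤ)
  bTerm-∈ i {F} e∈F
    rewrite dec-true (e ∈? F) e∈F | sign-delete e∈F = refl

  aTerm-∈ : ∀ i {F} → e ∈ F →
    aTerm i F ≡ (if does (k G F ℕ.≟ i) then - sign (F Subset.- e) else 0ℤ)
  aTerm-∈ i {F} e∈F rewrite sign-delete e∈F = refl

  -- The bridge terms of `F - e` vanish because `e` is absent from it. Writing the other terms
  -- through the sign of `F - e` leaves an instance of `pair-balance`.
  pair-terms : ∀ j F → e ∈ F → let F′ = F Subset.- e in
    (aTerm (ℕ.suc j) F′ + bTerm j F′) + (aTerm (ℕ.suc j) F + bTerm j F)
    ≡ bTerm (ℕ.suc j) F′ + bTerm (ℕ.suc j) F
  pair-terms j F e∈F
    rewrite bTerm-delete j F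
          | bTerm-delete (ℕ.suc j) F
          | ℤ.+-identityʳ (aTerm (ℕ.suc j) (F Subset.- e))
          | ℤ.+-identityˡ (bTerm (ℕ.suc j) F)
          | bTerm-∈ j e∈F
          | bTerm-∈ (ℕ.suc j) e∈F
          | aTerm-∈ (ℕ.suc j) e∈F
    = pair-balance (k G F) (k G (F Subset.- e)) j (sign (F Subset.- e)) (k-delete G e F)

  -- The additive form of the recurrence: with no subtraction, the left side is a single sum over
  -- subsets, to which the pairing applies.
  a+b≡b : 0 < order G → ∀ j → a G (ℕ.suc j) + b G e j ≡ b G e (ℕ.suc j)
  a+b≡b 0<V j = begin
    a G (ℕ.suc j) + b G e j
      ≡⟨ cong₂ _+_ (a≡∑aTerm (ℕ.suc j)) (b≡∑bTerm 0<V j) ⟩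
    ∑ (aTerm (ℕ.suc j)) Fs + ∑ (bTerm j) Fs
      ≡⟨ ∑-+ (aTerm (ℕ.suc j)) (bTerm j) Fs ⟨
    ∑ (λ F → aTerm (ℕ.suc j) F + bTerm j F) Fs
      ≡⟨ ∑-subsets-pair e (pair-terms j) ⟩
    ∑ (bTerm (ℕ.suc j)) Fs
      ≡⟨ b≡∑bTerm 0<V (ℕ.suc j) ⟨
    b G e (ℕ.suc j)  ∎
    where
    open ≡-Reasoning
    Fs = subsets (size G)

lemma2p4 : (G : SimpleGraph) → 0 < order G → 0 < size G → (e : E G) →
    ∀ i → 1 ≤ i → a G i ≡ b G e i - b G e (i ∸ 1)
lemma2p4 G 0<V _ e (ℕ.suc j) _ = trans
  (sym (//-rightDividesʳ (b G e j) (a G (ℕ.suc j))))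
  (cong (_- b G e j) (a+b≡b G e 0<V j))
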